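{- There exists $c>0$ such that, for all sufficiently large $n$, there are at least $2^{cn^2}$ pairwise non-isomorphic Ramsey saturated graphs on $n$ vertices.
   Context: The Ramsey number $r(G)$ of a graph $G$ is the smallest natural number $N$ such that every two-coloring of the edges of $K_N$ contains a monochromatic copy of $G$. A graph $G$ on $n$ vertices (viewed as a spanning subgraph of $K_n$) is Ramsey saturated if $r(G+e)>r(G)$ for every edge $e\in E(K_n)\setminus E(G)$, where $G+e$ is the graph obtained from $G$ by adding the edge $e$. -}

module Defs where

open import Data.Nat using (ℕ; _<_)
open import Data.Fin using (Fin; _≟_)
open import Data.Bool using (Bool; true; false; _∨_; _∧_)
open import Data.Product using (Σ; ∃; _×_; _,_)
open import Relation.Binary.PropositionalEquality using (_≡_; _≢_; refl; trans; cong₂)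
open import Data.Bool.Properties using (∧-comm; ∨-comm)
open import Data.Empty using (⊥-elim)
open import Relation.Nullary using (¬_; yes; no)
open import Relation.Nullary.Decidable using (⌊_⌋)
open import Function.Definitions using (Injective)
open import Function.Bundles using (_↔_; Inverse)

record Graph (n : ℕ) : Set where
  field
    adj   : Fin n → Fin n → Bool
    sym   : ∀ u v → adj u v ≡ adj v u
    irref : ∀ u → adj u u ≡ false
open Graph public

-- A two-colouring of the edges of K_N: a symmetric Bool-valued function on
-- pairs (values on the diagonal are irrelevant).
record Colouring (N : ℕ) : Set where
  field
    col    : Fin N → Fin N → Bool
    colSym : ∀ i j → col i j ≡ col j i
open Colouring public

MonoCopy : ∀ {n N} → Graph n → Colouring N → Set
MonoCopy {n} {N} G χ =
  Σ Bool λ b → Σ (Fin n → Fin N) λ f →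
    Injective _≡_ _≡_ f × (∀ u v → adj G u v ≡ true → col χ (f u) (f v) ≡ b)

Arrows : ∀ {n} → ℕ → Graph n → Set
Arrows N G = (χ : Colouring N) → MonoCopy G χ

IsRamseyNumber : ∀ {n} → Graph n → ℕ → Set
IsRamseyNumber G N = Arrows N G × (∀ M → M < N → ¬ Arrows M G)

addEdge : ∀ {n} (G : Graph n) (a b : Fin n) → a ≢ b → Graph n
addEdge {n} G a b a≢b = record
  { adj = A ; sym = symA ; irref = irrA }
  where
  is : Fin n → Fin n → Bool
  is u v = ⌊ u ≟ a ⌋ ∧ ⌊ v ≟ b ⌋ ∨ ⌊ u ≟ b ⌋ ∧ ⌊ v ≟ a ⌋
  A : Fin n → Fin n → Bool
  A u v = adj G u v ∨ is u v
  symA : ∀ u v → A u v ≡ A v u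
  symA u v = cong₂ _∨_ (Graph.sym G u v)
    (trans (cong₂ _∨_ (∧-comm ⌊ u ≟ a ⌋ _) (∧-comm ⌊ u ≟ b ⌋ _)) (∨-comm (⌊ v ≟ b ⌋ ∧ ⌊ u ≟ a ⌋) (⌊ v ≟ a ⌋ ∧ ⌊ u ≟ b ⌋)))
  isDiag : ∀ u → is u u ≡ false
  isDiag u with u ≟ a | u ≟ b
  ... | yes refl | yes refl = ⊥-elim (a≢b refl)
  ... | yes _ | no _ = refl
  ... | no _ | yes _ = refl
  ... | no _ | no _ = refl
  irrA : ∀ u → A u u ≡ false
  irrA u rewrite irref G u | isDiag u = refl

-- The Ramsey number is not defined as a function here; we use the
-- predicate IsRamseyNumber (its existence is Ramsey's theorem).
-- G is Ramsey saturated: r(G + e) > r(G) for every non-edge e = {a,b}.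
RamseySaturated : ∀ {n} → Graph n → Set
RamseySaturated {n} G =
  (a b : Fin n) (a≢b : a ≢ b) → adj G a b ≡ false →
  ∀ N₁ N₂ → IsRamseyNumber G N₁ → IsRamseyNumber (addEdge G a b a≢b) N₂ →
  N₁ < N₂

Isomorphic : ∀ {n} → Graph n → Graph n → Set
Isomorphic {n} G H =
  Σ (Fin n ↔ Fin n) λ σ →
    ∀ u v → adj G u v ≡ adj H (Inverse.to σ u) (Inverse.to σ v)

{-# OPTIONS --safe #-}

-- If H is edge-maximal among the graphs with Arrows N H, for one fixed N, then
-- r(H) ≤ N < r(H + e) for every non-edge e, so H is Ramsey saturated.  Hence
-- every graph G with Arrows N G has a Ramsey saturated supergraph H with
-- Arrows N H, and it remains to see that one H serves only few G.
--
-- Take for G the bipartite graphs on n = Δ K + B vertices in which each of the B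
-- right vertices selects one neighbour in each of Δ blocks of K left vertices;
-- there are K^(Δ B) of them.  Dependent random choice gives Arrows N G already
-- for N about 4^Δ n².  A random colouring shows 2^e(H) ≤ 2 N^n whenever
-- Arrows N H, and H contains at most 2^e(H) of the graphs G.  So the number k of
-- isomorphism classes of graphs H satisfies K^(Δ B) ≤ k n^n 2 N^n.  With K = 2^16
-- and Δ = n / 2K the left-hand side is at least 2^(8 Δ n) and the cofactor of k is
-- at most 2^(7 Δ n), which leaves k ≥ 2^(Δ n).
module Submission where

open import Defs hiding (sym)
open import Data.Bool using (Bool; true; false; if_then_else_)
open import Data.Bool.Properties as Bool using (∨-zeroʳ)
open import Data.Fin as Fin using (Fin; zero; suc; _↑ˡ_; _↑ʳ_; combine; finToFun; funToFin; inject≤; join; punchIn; punchOut; quotient; remainder; remQuot; splitAt)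
open import Data.Fin.Properties as Fin using (2↔Bool; finToFun-funToFin; inject≤-injective; join-splitAt; punchIn-injective; punchIn-punchOut; punchInᵢ≢i; punchOut-injective; remQuot-combine; splitAt-join; splitAt-↑ʳ; splitAt-↑ˡ; toℕ-↑ʳ; toℕ-↑ˡ; toℕ<n)
open import Data.List using (List; []; _∷_; cartesianProduct; allFin)
open import Data.List.Membership.Propositional.Properties using (∈-cartesianProduct⁺; ∈-allFin)
open import Data.List.Relation.Unary.All as All using (All; []; _∷_)
open import Data.Nat
open import Data.Nat.DivMod using (m≡m%n+[m/n]*n; m%n<n; m/n*n≤m; /-monoˡ-≤; m*n/n≡m)
open import Data.Nat.Properties
open import Data.Nat.Tactic.RingSolver using (solve-∀)
open import Data.Product using (Σ; ∃; _×_; _,_; proj₁; proj₂; uncurry)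
open import Data.Sum as Sum using (_⊎_; inj₁; inj₂)
open import Data.Sum.Properties using (inj₁-injective; inj₂-injective)
open import Function using (_∘_; id; Inverse; Injection)
open import Function.Construct.Symmetry using (↔-sym)
open import Function.Definitions using (Injective)
open import Function.Properties.Inverse using (↔⇒↣)
open import Relation.Binary using (tri<; tri≈; tri>)
open import Relation.Binary.PropositionalEquality
open import Relation.Nullary using (¬_; Dec; yes; no; contradiction)
open import Relation.Nullary.Decidable using (_×-dec_; _→-dec_; dec-false; dec-true; does; map′)
open import Relation.Unary using (Decidable)
import Algebra.Properties.CommutativeMonoid.Sum *-1-commutativeMonoid as Product
import Algebra.Properties.Semiring.Sum +-*-semiring as FinSum

private
  variable
    m n M N t : ℕ

-- Sums and products over Fin n

-- Opaque, so that unification treats the two operators as injective.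
opaque
  ∑ ∏ : ∀ n → (Fin n → ℕ) → ℕ
  ∑ n = FinSum.sum {n}
  ∏ n = Product.sum {n}

infixl 10 ∑ ∏
syntax ∑ n (λ i → x) = ∑[ i < n ] x
syntax ∏ n (λ i → x) = ∏[ i < n ] x

opaque
  unfolding ∑

  ∑-cong : {φ ψ : Fin n → ℕ} → φ ≗ ψ → ∑ n φ ≡ ∑ n ψ
  ∑-cong = FinSum.sum-cong-≗

  ∑-comm : (φ : Fin m → Fin n → ℕ) → ∑[ i < m ] ∑[ j < n ] φ i j ≡ ∑[ j < n ] ∑[ i < m ] φ i j
  ∑-comm = FinSum.∑-comm

  ∑-distrib-+ : (φ ψ : Fin n → ℕ) → ∑[ i < n ] (φ i + ψ i) ≡ ∑ n φ + ∑ n ψ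
  ∑-distrib-+ = FinSum.∑-distrib-+

  *-distribˡ-∑ : ∀ c (φ : Fin n → ℕ) → c * ∑ n φ ≡ ∑[ i < n ] (c * φ i)
  *-distribˡ-∑ = FinSum.*-distribˡ-sum

  *-distribʳ-∑ : ∀ c (φ : Fin n → ℕ) → ∑ n φ * c ≡ ∑[ i < n ] (φ i * c)
  *-distribʳ-∑ = FinSum.*-distribʳ-sum

  ∑-removeAt : (φ : Fin (suc n) → ℕ) (i : Fin (suc n)) → ∑ (suc n) φ ≡ φ i + ∑[ j < n ] φ (punchIn i j)
  ∑-removeAt φ i = FinSum.sum-remove {i = i} φ

  ∑-mono-≤ : {φ ψ : Fin n → ℕ} → (∀ i → φ i ≤ ψ i) → ∑ n φ ≤ ∑ n ψ
  ∑-mono-≤ {zero}  φ≤ψ = z≤n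
  ∑-mono-≤ {suc n} φ≤ψ = +-mono-≤ (φ≤ψ zero) (∑-mono-≤ (φ≤ψ ∘ suc))

  ∑-const : ∀ n c → ∑[ i < n ] c ≡ n * c
  ∑-const zero    c = refl
  ∑-const (suc n) c = cong (c +_) (∑-const n c)

  term≤∑ : (φ : Fin n → ℕ) (i : Fin n) → φ i ≤ ∑ n φ
  term≤∑ φ zero    = m≤m+n _ _
  term≤∑ φ (suc i) = ≤-trans (term≤∑ (φ ∘ suc) i) (m≤n+m _ _)

  ∑-<⇒∃< : (φ ψ : Fin n → ℕ) → ∑ n φ < ∑ n ψ → ∃ λ i → φ i < ψ i
  ∑-<⇒∃< {suc n} φ ψ ∑φ<∑ψ with φ zero <? ψ zero
  ... | yes φ₀<ψ₀ = zero , φ₀<ψ₀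
  ... | no  φ₀≮ψ₀ with i , φᵢ<ψᵢ ← ∑-<⇒∃< (φ ∘ suc) (ψ ∘ suc)
                        (+-cancelˡ-< (φ zero) _ _ (<-≤-trans ∑φ<∑ψ (+-monoˡ-≤ _ (≮⇒≥ φ₀≮ψ₀))))
    = suc i , φᵢ<ψᵢ

  ∑-split : ∀ m n (φ : Fin (m + n) → ℕ) →
            ∑ (m + n) φ ≡ ∑[ i < m ] φ (i ↑ˡ n) + ∑[ j < n ] φ (m ↑ʳ j)
  ∑-split zero    n φ = refl
  ∑-split (suc m) n φ = trans (cong (φ zero +_) (∑-split m n (φ ∘ suc))) (sym (+-assoc (φ zero) _ _))

  ∑-combine : ∀ m n (φ : Fin (m * n) → ℕ) →
              ∑ (m * n) φ ≡ ∑[ i < m ] ∑[ j < n ] φ (combine i j)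
  ∑-combine zero    n φ = refl
  ∑-combine (suc m) n φ =
    trans (∑-split n (m * n) φ) (cong (∑[ j < n ] φ (j ↑ˡ (m * n)) +_) (∑-combine m n (φ ∘ (n ↑ʳ_))))

  -- Induction on `n`: the other values of `f` avoid `f zero`, so they form an injection into the
  -- index set with that point removed.
  ∑-injective-≤ : (φ : Fin N → ℕ) (f : Fin n → Fin N) → Injective _≡_ _≡_ f →
                  ∑[ u < n ] φ (f u) ≤ ∑ N φ
  ∑-injective-≤ {N}     {zero}  φ f inj = z≤n
  ∑-injective-≤ {zero}  {suc n} φ f inj with () ← f zero
  ∑-injective-≤ {suc N} {suc n} φ f inj = begin
    φ f₀ + ∑[ u < n ] φ (f (suc u))
      ≡⟨ cong (φ f₀ +_) (∑-cong λ u → cong φ (punchIn-punchOut (f₀≢ u))) ⟨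
    φ f₀ + ∑[ u < n ] φ (punchIn f₀ (punchOut (f₀≢ u)))
      ≤⟨ +-monoʳ-≤ (φ f₀) (∑-injective-≤ (φ ∘ punchIn f₀) (λ u → punchOut (f₀≢ u))
           λ {u} {v} eq → Fin.suc-injective (inj (punchOut-injective (f₀≢ u) (f₀≢ v) eq))) ⟩
    φ f₀ + ∑[ j < N ] φ (punchIn f₀ j)
      ≡⟨ ∑-removeAt φ f₀ ⟨
    ∑ (suc N) φ ∎
    where
    open ≤-Reasoning
    f₀ : Fin (suc N)
    f₀ = f zero
    f₀≢ : ∀ u → f₀ ≢ f (suc u)
    f₀≢ u eq with () ← inj eq

opaque
  unfolding ∏

  ∏-cong : {φ ψ : Fin n → ℕ} → φ ≗ ψ → ∏ n φ ≡ ∏ n ψ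
  ∏-cong = Product.sum-cong-≗

  ∏-distrib-* : (φ ψ : Fin n → ℕ) → ∏[ i < n ] (φ i * ψ i) ≡ ∏ n φ * ∏ n ψ
  ∏-distrib-* = Product.∑-distrib-+

  ∏-mono-≤ : {φ ψ : Fin n → ℕ} → (∀ i → φ i ≤ ψ i) → ∏ n φ ≤ ∏ n ψ
  ∏-mono-≤ {zero}  φ≤ψ = ≤-refl
  ∏-mono-≤ {suc n} φ≤ψ = *-mono-≤ (φ≤ψ zero) (∏-mono-≤ (φ≤ψ ∘ suc))

  ∏-const : ∀ n c → ∏[ i < n ] c ≡ c ^ n
  ∏-const zero    c = refl
  ∏-const (suc n) c = cong (c *_) (∏-const n c)

∏-ones : {φ : Fin n → ℕ} → (∀ i → φ i ≡ 1) → ∏ n φ ≡ 1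
∏-ones {n} φ≡1 = trans (∏-cong φ≡1) (trans (∏-const n 1) (^-zeroˡ n))

opaque
  unfolding ∑ ∏

  ∏-^-∑ : ∀ n c (φ : Fin n → ℕ) → ∏[ i < n ] (c ^ φ i) ≡ c ^ ∑ n φ
  ∏-^-∑ zero    c φ = refl
  ∏-^-∑ (suc n) c φ = trans (cong (c ^ φ zero *_) (∏-^-∑ n c (φ ∘ suc))) (sym (^-distribˡ-+-* c (φ zero) _))

  -- The distributive law: expanding a product of sums yields one term per function. It serves as
  -- independence of coordinates when colourings, samples or choices are counted.
  ∑-∏ : ∀ m t (φ : Fin t → Fin m → ℕ) →
        ∑[ c < m ^ t ] ∏[ i < t ] φ i (finToFun c i) ≡ ∏[ i < t ] ∑[ x < m ] φ i x
  ∑-∏ m zero    φ = refl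
  ∑-∏ m (suc t) φ = begin
    ∑[ c < m * m ^ t ] (φ zero (quotient (m ^ t) c) * rest (remainder {m} (m ^ t) c))
      ≡⟨ ∑-combine m (m ^ t) _ ⟩
    ∑[ x < m ] ∑[ c < m ^ t ] (φ zero (quotient (m ^ t) (combine x c)) * rest (remainder {m} (m ^ t) (combine x c)))
      ≡⟨ ∑-cong (λ x → ∑-cong λ c → cong (λ (q , r) → φ zero q * rest r) (remQuot-combine x c)) ⟩
    ∑[ x < m ] ∑[ c < m ^ t ] (φ zero x * rest c)
      ≡⟨ ∑-cong (λ x → *-distribˡ-∑ (φ zero x) rest) ⟨
    ∑[ x < m ] (φ zero x * ∑ (m ^ t) rest)
      ≡⟨ *-distribʳ-∑ (∑ (m ^ t) rest) (φ zero) ⟨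
    ∑ m (φ zero) * ∑ (m ^ t) rest
      ≡⟨ cong (∑ m (φ zero) *_) (∑-∏ m t (φ ∘ suc)) ⟩
    ∑ m (φ zero) * ∏[ i < t ] ∑[ x < m ] φ (suc i) x ∎
    where
    open ≡-Reasoning
    rest : Fin (m ^ t) → ℕ
    rest c = ∏[ i < t ] φ (suc i) (finToFun c i)

-- Indicators and distinct representatives

𝟙 : {P : Set} → Dec P → ℕ
𝟙 (yes _) = 1
𝟙 (no _)  = 0

𝟙-yes : {P : Set} (P? : Dec P) → P → 𝟙 P? ≡ 1
𝟙-yes (yes _) p = refl
𝟙-yes (no ¬p) p = contradiction p ¬p

𝟙-no : {P : Set} (P? : Dec P) → ¬ P → 𝟙 P? ≡ 0
𝟙-no (yes p) ¬p = contradiction p ¬p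
𝟙-no (no _)  ¬p = refl

𝟙≤1 : {P : Set} (P? : Dec P) → 𝟙 P? ≤ 1
𝟙≤1 (yes _) = ≤-refl
𝟙≤1 (no _)  = z≤n

0<𝟙⇒ : {P : Set} (P? : Dec P) → 0 < 𝟙 P? → P
0<𝟙⇒ (yes p) _ = p

𝟙-mono : {P Q : Set} (P? : Dec P) (Q? : Dec Q) → (P → Q) → 𝟙 P? ≤ 𝟙 Q?
𝟙-mono (yes p) Q? P⇒Q = ≤-reflexive (sym (𝟙-yes Q? (P⇒Q p)))
𝟙-mono (no _)  Q? P⇒Q = z≤n

-- Greedy: the value taken by index `zero` costs every other index at most one candidate, so the
-- remaining `m` indices keep at least `m` candidates each.
distinct-representatives :
  {P : Fin m → Fin N → Set} (P? : ∀ i x → Dec (P i x)) →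
  (∀ i → m ≤ ∑[ x < N ] 𝟙 (P? i x)) →
  Σ (Fin m → Fin N) λ f → Injective _≡_ _≡_ f × (∀ i → P i (f i))
distinct-representatives {zero} P? large = (λ ()) , (λ { {()} }) , λ ()
distinct-representatives {suc m} {zero}  P? large
  with () ← ≤-trans (large zero) (≤-trans (∑-mono-≤ (𝟙≤1 ∘ P? zero)) (≤-reflexive (∑-const 0 1)))
distinct-representatives {suc m} {suc N} {P} P? large
  with x , 0<𝟙 ← ∑-<⇒∃< {suc N} (λ _ → 0) (λ x → 𝟙 (P? zero x))
         (<-≤-trans (≤-reflexive (cong suc (trans (∑-const (suc N) 0) (*-zeroʳ N)))) (≤-trans (s≤s z≤n) (large zero)))
  with f , f-inj , Pf ← distinct-representatives (λ i y → P? (suc i) (punchIn x y)) (λ i →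
         s≤s⁻¹ (≤-trans (large (suc i)) (≤-trans (≤-reflexive (∑-removeAt (λ y → 𝟙 (P? (suc i) y)) x)) (+-monoˡ-≤ _ (𝟙≤1 (P? (suc i) x))))))
  = g , (λ {u} {v} → g-inj u v) , Pg
  where
  g : Fin (suc m) → Fin (suc N)
  g zero    = x
  g (suc i) = punchIn x (f i)
  g-inj : ∀ u v → g u ≡ g v → u ≡ v
  g-inj zero    zero    eq = refl
  g-inj zero    (suc v) eq = contradiction (sym eq) (punchInᵢ≢i x (f v))
  g-inj (suc u) zero    eq = contradiction eq (punchInᵢ≢i x (f u))
  g-inj (suc u) (suc v) eq = cong suc (f-inj (punchIn-injective x _ _ eq))
  Pg : ∀ i → P i (g i)
  Pg zero    = 0<𝟙⇒ (P? zero x) 0<𝟙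
  Pg (suc i) = Pf i

opaque
  unfolding ∏

  ∏-zero : (φ : Fin n → ℕ) (i : Fin n) → φ i ≡ 0 → ∏ n φ ≡ 0
  ∏-zero φ zero    φᵢ≡0 rewrite φᵢ≡0 = refl
  ∏-zero φ (suc i) φᵢ≡0 rewrite ∏-zero (φ ∘ suc) i φᵢ≡0 = *-zeroʳ (φ zero)

𝟙-all : {P : Fin n → Set} (P? : ∀ i → Dec (P i)) → 𝟙 (Fin.all? P?) ≡ ∏[ i < n ] 𝟙 (P? i)
𝟙-all {n} {P} P? with Fin.all? P?
... | yes p = sym (∏-ones λ i → 𝟙-yes (P? i) (p i))
... | no ¬p with i , ¬pᵢ ← Fin.¬∀⟶∃¬ n P P? ¬p = sym (∏-zero _ i (𝟙-no (P? i) ¬pᵢ))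

^-distribʳ-* : ∀ t m n → (m * n) ^ t ≡ m ^ t * n ^ t
^-distribʳ-* t m n = trans (sym (∏-const t (m * n)))
  (trans (∏-distrib-* {t} (λ _ → m) (λ _ → n)) (cong₂ _*_ (∏-const t m) (∏-const t n)))

-- Decidability of the arrow relation

∃-function? : {P : (Fin t → Fin m) → Set} → (∀ {f g} → f ≗ g → P f → P g) → Decidable P → Dec (∃ P)
∃-function? resp P? = map′
  (λ (c , p) → finToFun c , p)
  -- Decoding the code of `f` returns `f` only pointwise, which is why `P` has to respect `≗`.
  (λ (f , p) → funToFin f , resp (sym ∘ finToFun-funToFin f) p)
  (Fin.any? (P? ∘ finToFun))

injective? : (f : Fin m → Fin n) → Dec (Injective _≡_ _≡_ f)
injective? f = map′ (λ inj {u} {v} → inj u v) (λ inj u v → inj)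
  (Fin.all? λ u → Fin.all? λ v → (f u Fin.≟ f v) →-dec (u Fin.≟ v))

Injective-≗ : {f g : Fin m → Fin n} → f ≗ g → Injective _≡_ _≡_ f → Injective _≡_ _≡_ g
Injective-≗ f≗g inj {u} {v} eq = inj (trans (f≗g u) (trans eq (sym (f≗g v))))

_⊆_ : Graph n → Graph n → Set
G ⊆ H = ∀ u v → adj G u v ≡ true → adj H u v ≡ true

_⊆?_ : (G H : Graph n) → Dec (G ⊆ H)
G ⊆? H = Fin.all? λ u → Fin.all? λ v → (adj G u v Bool.≟ true) →-dec (adj H u v Bool.≟ true)

IsMonoCopy : Graph n → Colouring N → Bool → (Fin n → Fin N) → Set
IsMonoCopy G χ b f = Injective _≡_ _≡_ f × (∀ u v → adj G u v ≡ true → col χ (f u) (f v) ≡ b)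

IsMonoCopy-≗ : {G : Graph n} {χ : Colouring N} {b : Bool} {f g : Fin n → Fin N} →
               f ≗ g → IsMonoCopy G χ b f → IsMonoCopy G χ b g
IsMonoCopy-≗ {χ = χ} f≗g (inj , mono) =
  Injective-≗ f≗g inj , λ u v uv → trans (sym (cong₂ (col χ) (f≗g u) (f≗g v))) (mono u v uv)

MonoCopy? : (G : Graph n) (χ : Colouring N) → Dec (MonoCopy G χ)
MonoCopy? G χ = map′ (λ (z , copy) → bit z , copy)
  (λ (b , copy) → Inverse.from 2↔Bool b , subst (∃ ∘ IsMonoCopy G χ) (sym (Inverse.strictlyInverseˡ 2↔Bool b)) copy)
  (Fin.any? λ z → ∃-function? (IsMonoCopy-≗ {G = G} {χ}) λ f →
    injective? f ×-dec Fin.all? λ u → Fin.all? λ v →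
      (adj G u v Bool.≟ true) →-dec (col χ (f u) (f v) Bool.≟ bit z))
  where
  bit : Fin 2 → Bool
  bit = Inverse.to 2↔Bool

-- Both orders of a pair read the same bit, so any bit string yields a symmetric colouring.
pairIndex : Fin N → Fin N → Fin (N * N)
pairIndex x y = if does (x Fin.<? y) then combine x y else combine y x

pairIndex-< : {x y : Fin N} → x Fin.< y → pairIndex x y ≡ combine x y
pairIndex-< {x = x} {y} x<y rewrite dec-true (x Fin.<? y) x<y = refl

pairIndex-≮ : {x y : Fin N} → ¬ x Fin.< y → pairIndex x y ≡ combine y x
pairIndex-≮ {x = x} {y} x≮y rewrite dec-false (x Fin.<? y) x≮y = refl

pairIndex-sym : (x y : Fin N) → pairIndex x y ≡ pairIndex y x
pairIndex-sym x y with Fin.<-cmp x y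
... | tri< x<y _ y≮x = trans (pairIndex-< x<y) (sym (pairIndex-≮ y≮x))
... | tri≈ _ refl _  = refl
... | tri> x≮y _ y<x = trans (pairIndex-≮ x≮y) (sym (pairIndex-< y<x))

-- Only the bits at positions combine x y with x < y matter.
colouring : (Fin (N * N) → Fin 2) → Colouring N
colouring c = record
  { col    = λ x y → Inverse.to 2↔Bool (c (pairIndex x y))
  ; colSym = λ x y → cong (Inverse.to 2↔Bool ∘ c) (pairIndex-sym x y)
  }

colourBits : Colouring N → Fin (N * N) → Fin 2
colourBits {N} χ e = Inverse.from 2↔Bool (uncurry (col χ) (remQuot {N} N e))

col-colourBits : (χ : Colouring N) {c : Fin (N * N) → Fin 2} → c ≗ colourBits χ →
                 ∀ x y → col (colouring c) x y ≡ col χ x y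
col-colourBits {N} χ {c} c≗ x y = trans (cong (Inverse.to 2↔Bool) (c≗ (pairIndex x y)))
  (trans (Inverse.strictlyInverseˡ 2↔Bool _) (col-pairIndex (x Fin.<? y)))
  where
  col-pairIndex : Dec (x Fin.< y) → uncurry (col χ) (remQuot {N} N (pairIndex x y)) ≡ col χ x y
  col-pairIndex (yes x<y) rewrite pairIndex-< x<y = cong (uncurry (col χ)) (remQuot-combine x y)
  col-pairIndex (no x≮y)  rewrite pairIndex-≮ x≮y =
    trans (cong (uncurry (col χ)) (remQuot-combine y x)) (colSym χ y x)

MonoCopy-cong : {G : Graph n} {χ χ′ : Colouring N} → (∀ x y → col χ x y ≡ col χ′ x y) →
                MonoCopy G χ → MonoCopy G χ′
MonoCopy-cong χ≗χ′ (b , f , inj , mono) = b , f , inj , λ u v uv → trans (sym (χ≗χ′ (f u) (f v))) (mono u v uv)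

-- Every colouring agrees pointwise with one of the `2 ^ (N * N)` decoded ones. This decision is
-- what lets `saturateAlong` accept or reject an edge.
Arrows? : (N : ℕ) (G : Graph n) → Dec (Arrows N G)
Arrows? N G = map′
  (λ mono χ → let c = funToFin (colourBits χ) in
    MonoCopy-cong {G = G} {colouring (finToFun c)} {χ} (col-colourBits χ (finToFun-funToFin (colourBits χ))) (mono c))
  (λ arrows c → arrows (colouring (finToFun c)))
  (Fin.all? λ c → MonoCopy? G (colouring (finToFun {2} {N * N} c)))

-- Saturation at a fixed number of colouring vertices

Arrows-⊆ : {G H : Graph n} → G ⊆ H → Arrows N H → Arrows N G
Arrows-⊆ G⊆H arrows χ with b , f , inj , mono ← arrows χ = b , f , inj , λ u v uv → mono u v (G⊆H u v uv)

Arrows-≤ : {G : Graph n} → M ≤ N → Arrows M G → Arrows N G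
Arrows-≤ M≤N arrows χ
  with b , f , inj , mono ← arrows (record { col    = λ x y → col χ (inject≤ x M≤N) (inject≤ y M≤N)
                                           ; colSym = λ x y → colSym χ _ _ })
  = b , (λ u → inject≤ (f u) M≤N) , inj ∘ inject≤-injective M≤N M≤N _ _ , mono

⊆-refl : {G : Graph n} → G ⊆ G
⊆-refl u v uv = uv

⊆-trans : {G H I : Graph n} → G ⊆ H → H ⊆ I → G ⊆ I
⊆-trans G⊆H H⊆I u v = H⊆I u v ∘ G⊆H u v

⊆-addEdge : {G : Graph n} {a b : Fin n} (a≢b : a ≢ b) → G ⊆ addEdge G a b a≢b
⊆-addEdge a≢b u v uv rewrite uv = refl

addEdge-⊆ : {G H : Graph n} {a b : Fin n} (a≢b : a ≢ b) → G ⊆ H → addEdge G a b a≢b ⊆ addEdge H a b a≢b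
addEdge-⊆ {G = G} {H} a≢b G⊆H u v uv with adj G u v in eq | uv
... | true  | _   rewrite G⊆H u v eq = refl
... | false | uv′ rewrite uv′ = ∨-zeroʳ (adj H u v)

adj-addEdge : {G : Graph n} {a b : Fin n} (a≢b : a ≢ b) → adj (addEdge G a b a≢b) a b ≡ true
adj-addEdge {G = G} {a} {b} a≢b
  rewrite ≡-≟-identity Fin._≟_ (refl {x = a}) | ≡-≟-identity Fin._≟_ (refl {x = b}) = ∨-zeroʳ (adj G a b)

-- Vacuous on the diagonal, so that simply all pairs of vertices can be listed.
Unextendable : ℕ → Graph n → Fin n × Fin n → Set
Unextendable N H (a , b) = (a≢b : a ≢ b) → adj H a b ≡ false → ¬ Arrows N (addEdge H a b a≢b)

-- A single greedy pass suffices: an edge rejected for the current graph stays rejected for every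
-- supergraph, because `Arrows` passes to subgraphs.
saturateAlong : (es : List (Fin n × Fin n)) (G : Graph n) → Arrows N G →
                Σ (Graph n) λ H → G ⊆ H × Arrows N H × All (Unextendable N H) es
saturateAlong [] G arrows = G , ⊆-refl {G = G} , arrows , []
saturateAlong {N = N} ((a , b) ∷ es) G arrows with a Fin.≟ b
... | yes a≡b with H , G⊆H , arrowsH , unext ← saturateAlong es G arrows
    = H , G⊆H , arrowsH , (λ a≢b → contradiction a≡b a≢b) ∷ unext
... | no a≢b with Arrows? N (addEdge G a b a≢b)
...   | yes arrows⁺ with H , G⁺⊆H , arrowsH , unext ← saturateAlong es (addEdge G a b a≢b) arrows⁺
      = H , ⊆-trans {G = G} {addEdge G a b a≢b} {H} (⊆-addEdge {G = G} a≢b) G⁺⊆H , arrowsH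
      , (λ _ ab∉H → contradiction (trans (sym ab∉H) (G⁺⊆H a b (adj-addEdge {G = G} a≢b))) λ ()) ∷ unext
...   | no ¬arrows⁺ with H , G⊆H , arrowsH , unext ← saturateAlong es G arrows
      = H , G⊆H , arrowsH
      , (λ a≢b′ _ arrowsH⁺ → ¬arrows⁺ (Arrows-⊆ {G = addEdge G a b a≢b} {addEdge H a b a≢b′} (addEdge-⊆ {G = G} {H} a≢b G⊆H) arrowsH⁺)) ∷ unext

-- `N` separates the two Ramsey numbers: minimality of `N₁` gives `N₁ ≤ N`, while `N₂ ≤ N` would
-- make the extended graph arrow at `N`.
unextendable⇒saturated : {H : Graph n} → Arrows N H → (∀ a b → Unextendable N H (a , b)) → RamseySaturated H
unextendable⇒saturated {N = N} {H} arrows unext a b a≢b ab∉H N₁ N₂ (_ , N₁-least) (arrows₂ , _) =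
  ≤-<-trans (≮⇒≥ λ N<N₁ → N₁-least N N<N₁ arrows)
            (≰⇒> λ N₂≤N → unext a b a≢b ab∉H (Arrows-≤ {G = addEdge H a b a≢b} N₂≤N arrows₂))

saturate : (G : Graph n) → Arrows N G → Σ (Graph n) λ H → G ⊆ H × Arrows N H × RamseySaturated H
saturate {n} G arrows with H , G⊆H , arrowsH , unext ← saturateAlong (cartesianProduct (allFin n) (allFin n)) G arrows
  = H , G⊆H , arrowsH
  , unextendable⇒saturated {H = H} arrowsH (λ a b → All.lookup unext (∈-cartesianProduct⁺ (∈-allFin a) (∈-allFin b)))

-- Arrows N H leaves room for few edges

edge : Graph n → Fin n → Fin n → ℕ
edge G u v = 𝟙 (adj G u v Bool.≟ true)

-- For injective `f` each edge is counted once, in the orientation that increases under `f`. This is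
-- the orientation in which `pairIndex` stores the colour of its image.
edges : (Fin n → Fin N) → Graph n → ℕ
edges {n} f G = ∑[ u < n ] ∑[ v < n ] (𝟙 (f u Fin.<? f v) * edge G u v)

2*edges : (f : Fin n → Fin N) → Injective _≡_ _≡_ f → (G : Graph n) →
          edges f G + edges f G ≡ ∑[ u < n ] ∑[ v < n ] edge G u v
2*edges {n} f f-inj G = begin
  edges f G + edges f G
    ≡⟨ cong (edges f G +_) (∑-comm (λ u v → 𝟙 (f u Fin.<? f v) * edge G u v)) ⟩
  edges f G + ∑[ v < n ] ∑[ u < n ] (𝟙 (f u Fin.<? f v) * edge G u v)
    ≡⟨ ∑-distrib-+ _ _ ⟨
  ∑[ u < n ] (∑[ v < n ] (𝟙 (f u Fin.<? f v) * edge G u v) + ∑[ v < n ] (𝟙 (f v Fin.<? f u) * edge G v u))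
    ≡⟨ ∑-cong (λ u → trans (sym (∑-distrib-+ _ _)) (∑-cong (ordered u))) ⟩
  ∑[ u < n ] ∑[ v < n ] edge G u v ∎
  where
  open ≡-Reasoning
  ordered : ∀ u v → 𝟙 (f u Fin.<? f v) * edge G u v + 𝟙 (f v Fin.<? f u) * edge G v u ≡ edge G u v
  ordered u v with Fin.<-cmp (f u) (f v)
  ... | tri< fu<fv _ fv≮fu rewrite 𝟙-yes (f u Fin.<? f v) fu<fv | 𝟙-no (f v Fin.<? f u) fv≮fu =
    trans (+-identityʳ _) (*-identityˡ _)
  ... | tri> fu≮fv _ fv<fu rewrite 𝟙-no (f u Fin.<? f v) fu≮fv | 𝟙-yes (f v Fin.<? f u) fv<fu | Graph.sym G u v =
    *-identityˡ _
  -- By injectivity `u` and `v` coincide, and a loop contributes nothing.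
  ... | tri≈ _ fu≡fv _ with refl ← f-inj fu≡fv
    rewrite irref G u | *-zeroʳ (𝟙 (f u Fin.<? f u)) = refl

-- Twice either count is the degree sum, which does not mention `f`.
edges-injective : (f : Fin n → Fin N) → Injective _≡_ _≡_ f → (G : Graph n) → edges f G ≡ edges id G
edges-injective f f-inj G =
  *-cancelˡ-≡ _ _ 2 (trans (double (edges f G)) (trans (trans (2*edges f f-inj G) (sym (2*edges id id G))) (sym (double (edges id G)))))
  where
  double : ∀ m → 2 * m ≡ m + m
  double m = cong (m +_) (+-identityʳ m)

-- The positions of the bit string whose values a monochromatic copy along `f` forces.
CopyPair : Graph n → (Fin n → Fin N) → Fin (N * N) → Set
CopyPair G f e = ∃ λ u → ∃ λ v → e ≡ combine (f u) (f v) × f u Fin.< f v × adj G u v ≡ true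

CopyPair? : (G : Graph n) (f : Fin n → Fin N) (e : Fin (N * N)) → Dec (CopyPair G f e)
CopyPair? G f e = Fin.any? λ u → Fin.any? λ v →
  (e Fin.≟ combine (f u) (f v)) ×-dec (f u Fin.<? f v) ×-dec (adj G u v Bool.≟ true)

-- Distinct edges occupy distinct positions. The sums over images under `f` are enlarged to all of
-- `Fin N` one coordinate at a time.
edges≤copyPairs : (G : Graph n) (f : Fin n → Fin N) → Injective _≡_ _≡_ f →
                  edges f G ≤ ∑[ e < N * N ] 𝟙 (CopyPair? G f e)
edges≤copyPairs {n} {N} G f f-inj = begin
  edges f G
    ≤⟨ ∑-mono-≤ (λ u → ∑-mono-≤ (pair u)) ⟩
  ∑[ u < n ] ∑[ v < n ] 𝟙 (CopyPair? G f (combine (f u) (f v)))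
    ≤⟨ ∑-mono-≤ (λ u → ∑-injective-≤ (λ y → 𝟙 (CopyPair? G f (combine (f u) y))) f f-inj) ⟩
  ∑[ u < n ] ∑[ y < N ] 𝟙 (CopyPair? G f (combine (f u) y))
    ≤⟨ ∑-injective-≤ (λ x → ∑[ y < N ] 𝟙 (CopyPair? G f (combine x y))) f f-inj ⟩
  ∑[ x < N ] ∑[ y < N ] 𝟙 (CopyPair? G f (combine x y))
    ≡⟨ ∑-combine N N _ ⟨
  ∑[ e < N * N ] 𝟙 (CopyPair? G f e) ∎
  where
  open ≤-Reasoning
  pair : ∀ u v → 𝟙 (f u Fin.<? f v) * edge G u v ≤ 𝟙 (CopyPair? G f (combine (f u) (f v)))
  pair u v with f u Fin.<? f v
  ... | no _ = z≤n
  ... | yes fu<fv rewrite *-identityˡ (edge G u v) =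
    𝟙-mono (adj G u v Bool.≟ true) (CopyPair? G f _) λ uv → u , v , refl , fu<fv , uv

opaque
  unfolding ∑

  -- A forced position has one admissible value and weight 2, a free one has two values and weight
  -- 1. The weights stand in for a division by a power of 2.
  forced-bit : {P : Set} (P? : Dec P) (z : Fin 2) →
               ∑[ x < 2 ] 𝟙 (P? →-dec (x Fin.≟ z)) * 2 ^ 𝟙 P? ≡ 2
  forced-bit (yes p) zero       = refl
  forced-bit (yes p) (suc zero) = refl
  forced-bit (no ¬p) z          = refl

arrows⇒few-edges : (G : Graph n) → Arrows N G → 2 ^ edges id G ≤ 2 * N ^ n
arrows⇒few-edges {n} {N} G arrows = *-cancelˡ-≤ (2 ^ L) {{m^n≢0 2 L}} (begin
  2 ^ L * 2 ^ edges id G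
    ≡⟨ cong (_* 2 ^ edges id G) (trans (∑-const (2 ^ L) 1) (*-identityʳ (2 ^ L))) ⟨
  ∑[ c < 2 ^ L ] 1 * 2 ^ edges id G
    ≤⟨ *-monoˡ-≤ (2 ^ edges id G) (∑-mono-≤ covered) ⟩
  ∑[ c < 2 ^ L ] ∑[ z < 2 ] ∑[ f < N ^ n ] weight z (finToFun f) (finToFun c) * 2 ^ edges id G
    ≡⟨ cong (_* 2 ^ edges id G) (trans (∑-comm _) (∑-cong λ z → ∑-comm (λ c f → weight z (finToFun f) (finToFun c)))) ⟩
  ∑[ z < 2 ] ∑[ f < N ^ n ] ∑[ c < 2 ^ L ] weight z (finToFun f) (finToFun c) * 2 ^ edges id G
    ≡⟨ trans (*-distribʳ-∑ (2 ^ edges id G) _) (∑-cong λ z → *-distribʳ-∑ (2 ^ edges id G) _) ⟩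
  ∑[ z < 2 ] ∑[ f < N ^ n ] (∑[ c < 2 ^ L ] weight z (finToFun f) (finToFun c) * 2 ^ edges id G)
    ≤⟨ ∑-mono-≤ (λ z → ∑-mono-≤ λ f → total z (finToFun f)) ⟩
  ∑[ z < 2 ] ∑[ f < N ^ n ] (2 ^ L)
    ≡⟨ trans (∑-const 2 _) (cong (2 *_) (∑-const (N ^ n) (2 ^ L))) ⟩
  2 * (N ^ n * 2 ^ L)
    ≡⟨ rearrange (N ^ n) (2 ^ L) ⟩
  2 ^ L * (2 * N ^ n) ∎)
  where
  open ≤-Reasoning
  L = N * N
  rearrange : ∀ a b → 2 * (a * b) ≡ b * (2 * a)
  rearrange = solve-∀
  agrees : Fin 2 → (Fin n → Fin N) → Fin L → Fin 2 → ℕ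
  agrees z f e x = 𝟙 (CopyPair? G f e →-dec (x Fin.≟ z))
  weight : Fin 2 → (Fin n → Fin N) → (Fin L → Fin 2) → ℕ
  weight z f c = 𝟙 (injective? f) * ∏[ e < L ] agrees z f e (c e)

  covered : ∀ c → 1 ≤ ∑[ z < 2 ] ∑[ f < N ^ n ] weight z (finToFun f) (finToFun c)
  covered c with b , f , copy ← arrows (colouring (finToFun c))
            with inj , mono ← IsMonoCopy-≗ {G = G} {colouring (finToFun c)} (sym ∘ finToFun-funToFin f) copy = begin
    1
      ≡⟨ cong₂ _*_ (𝟙-yes (injective? f′) inj) (∏-ones λ e → 𝟙-yes (CopyPair? G f′ e →-dec _) (bit e)) ⟨
    weight z f′ (finToFun c)
      ≤⟨ term≤∑ (λ g → weight z (finToFun g) (finToFun c)) (funToFin f) ⟩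
    ∑[ g < N ^ n ] weight z (finToFun g) (finToFun c)
      ≤⟨ term≤∑ _ z ⟩
    ∑[ z < 2 ] ∑[ g < N ^ n ] weight z (finToFun g) (finToFun c) ∎
    where
    f′ = finToFun (funToFin f)
    z = Inverse.from 2↔Bool b
    bit : ∀ e → CopyPair G f′ e → finToFun c e ≡ z
    bit e (u , v , refl , fu<fv , uv) = sym (Inverse.inverseʳ 2↔Bool
      (trans (sym (mono u v uv)) (cong (Inverse.to 2↔Bool ∘ finToFun c) (pairIndex-< fu<fv))))

  total : ∀ z f → ∑[ c < 2 ^ L ] weight z f (finToFun c) * 2 ^ edges id G ≤ 2 ^ L
  total z f with injective? f
  ... | no _ rewrite ∑-const (2 ^ L) 0 | *-zeroʳ (2 ^ L) = z≤n
  ... | yes inj = begin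
    ∑[ c < 2 ^ L ] (1 * ∏[ e < L ] agrees z f e (finToFun c e)) * 2 ^ edges id G
      -- Positions are independent, so the sum over strings becomes a product over positions. The
      -- exponent is rewritten along `f` to be compared with the forced positions.
      ≡⟨ cong₂ (λ s h → s * 2 ^ h) (trans (∑-cong λ c → *-identityˡ _) (∑-∏ 2 L (agrees z f))) (sym (edges-injective f inj G)) ⟩
    ∏[ e < L ] ∑[ x < 2 ] agrees z f e x * 2 ^ edges f G
      ≤⟨ *-monoʳ-≤ (∏[ e < L ] ∑[ x < 2 ] agrees z f e x) (^-monoʳ-≤ 2 (edges≤copyPairs G f inj)) ⟩
    ∏[ e < L ] ∑[ x < 2 ] agrees z f e x * 2 ^ ∑[ e < L ] 𝟙 (CopyPair? G f e)
      ≡⟨ cong (∏[ e < L ] ∑[ x < 2 ] agrees z f e x *_) (∏-^-∑ L 2 _) ⟨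
    ∏[ e < L ] ∑[ x < 2 ] agrees z f e x * ∏[ e < L ] (2 ^ 𝟙 (CopyPair? G f e))
      ≡⟨ ∏-distrib-* _ _ ⟨
    ∏[ e < L ] (∑[ x < 2 ] agrees z f e x * 2 ^ 𝟙 (CopyPair? G f e))
      ≡⟨ ∏-cong (λ e → forced-bit (CopyPair? G f e) z) ⟩
    ∏[ e < L ] 2
      ≡⟨ ∏-const L 2 ⟩
    2 ^ L ∎

-- Dependent random choice

opaque
  unfolding ∑

  bits-partition : (x : Fin 2) → ∑[ z < 2 ] 𝟙 (x Fin.≟ z) ≡ 1
  bits-partition zero       = refl
  bits-partition (suc zero) = refl

  -- The sum is at most twice its larger term. This is the power mean inequality up to a factor 2.
  ∑-bits-^ : ∀ t (φ : Fin 2 → ℕ) → ∑ 2 φ ^ t ≤ 2 ^ t * ∑[ z < 2 ] (φ z ^ t)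
  ∑-bits-^ t φ rewrite +-identityʳ (φ (suc zero)) | +-identityʳ (φ (suc zero) ^ t) with ≤-total (φ zero) (φ (suc zero))
  ... | inj₁ φ₀≤φ₁ = begin
    (φ zero + φ (suc zero)) ^ t           ≤⟨ ^-monoˡ-≤ t (+-monoˡ-≤ (φ (suc zero)) φ₀≤φ₁) ⟩
    (φ (suc zero) + φ (suc zero)) ^ t     ≡⟨ cong (λ s → (φ (suc zero) + s) ^ t) (+-identityʳ (φ (suc zero))) ⟨
    (2 * φ (suc zero)) ^ t                ≡⟨ ^-distribʳ-* t 2 (φ (suc zero)) ⟩
    2 ^ t * φ (suc zero) ^ t              ≤⟨ *-monoʳ-≤ (2 ^ t) (m≤n+m _ _) ⟩
    2 ^ t * (φ zero ^ t + φ (suc zero) ^ t) ∎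
    where open ≤-Reasoning
  ... | inj₂ φ₁≤φ₀ = begin
    (φ zero + φ (suc zero)) ^ t           ≤⟨ ^-monoˡ-≤ t (+-monoʳ-≤ (φ zero) φ₁≤φ₀) ⟩
    (φ zero + φ zero) ^ t                 ≡⟨ cong (λ s → (φ zero + s) ^ t) (+-identityʳ (φ zero)) ⟨
    (2 * φ zero) ^ t                      ≡⟨ ^-distribʳ-* t 2 (φ zero) ⟩
    2 ^ t * φ zero ^ t                    ≤⟨ *-monoʳ-≤ (2 ^ t) (m≤m+n _ _) ⟩
    2 ^ t * (φ zero ^ t + φ (suc zero) ^ t) ∎
    where open ≤-Reasoning

module BipartiteColouring {M : ℕ} (c : Fin M → Fin M → Fin 2) where

  HasColour? : ∀ z x y → Dec (c x y ≡ z)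
  HasColour? z x y = c x y Fin.≟ z

  Joined : Fin 2 → (Fin m → Fin M) → Fin M → Set
  Joined z S y = ∀ j → c (S j) y ≡ z

  Joined? : ∀ z (S : Fin m → Fin M) y → Dec (Joined z S y)
  Joined? z S y = Fin.all? λ j → HasColour? z (S j) y

  codegree : Fin 2 → (Fin m → Fin M) → ℕ
  codegree z S = ∑[ y < M ] 𝟙 (Joined? z S y)

module DependentRandomChoice {M : ℕ} (c : Fin M → Fin M → Fin 2) (Δ n t : ℕ) where

  open BipartiteColouring c

  Chosen? : ∀ z (T : Fin t → Fin M) x → Dec (∀ i → c x (T i) ≡ z)
  Chosen? z T x = Fin.all? λ i → HasColour? z x (T i)

  -- The size of the common neighbourhood of the sample `T` in colour `z`, the random set of
  -- dependent random choice.
  chosen : Fin 2 → (Fin t → Fin M) → ℕ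
  chosen z T = ∑[ x < M ] 𝟙 (Chosen? z T x)

  -- The second factor, read from the side of `S`, says that every entry of `S` is chosen by `T`.
  badTuple : Fin 2 → (Fin t → Fin M) → (Fin Δ → Fin M) → ℕ
  badTuple z T S = 𝟙 (codegree z S <? n) * 𝟙 (Fin.all? λ i → Joined? z S (T i))

  badTuples : Fin 2 → (Fin t → Fin M) → ℕ
  badTuples z T = ∑[ S < M ^ Δ ] badTuple z T (finToFun S)

  chosen≤ : ∀ z T → chosen z T ≤ M
  chosen≤ z T = ≤-trans (∑-mono-≤ (𝟙≤1 ∘ Chosen? z T)) (≤-reflexive (trans (∑-const M 1) (*-identityʳ M)))

  -- Double counting: `x` is chosen by `degree z x ^ t` samples, and its degrees in the two colours
  -- add up to `M`.
  ∑-chosen : M ^ t * M ≤ 2 ^ t * ∑[ z < 2 ] ∑[ T < M ^ t ] chosen z (finToFun T)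
  ∑-chosen = begin
    M ^ t * M
      ≡⟨ *-comm (M ^ t) M ⟩
    M * M ^ t
      ≡⟨ ∑-const M (M ^ t) ⟨
    ∑[ x < M ] (M ^ t)
      ≡⟨ ∑-cong (λ x → cong (_^ t) (degrees x)) ⟨
    ∑[ x < M ] (∑[ z < 2 ] degree z x ^ t)
      ≤⟨ ∑-mono-≤ (λ x → ∑-bits-^ t (λ z → degree z x)) ⟩
    ∑[ x < M ] (2 ^ t * ∑[ z < 2 ] (degree z x ^ t))
      ≡⟨ *-distribˡ-∑ (2 ^ t) _ ⟨
    2 ^ t * ∑[ x < M ] ∑[ z < 2 ] (degree z x ^ t)
      ≡⟨ cong (2 ^ t *_) (trans (∑-comm _) (∑-cong λ z → trans (∑-cong λ x → sym (choices z x)) (∑-comm _))) ⟩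
    2 ^ t * ∑[ z < 2 ] ∑[ T < M ^ t ] chosen z (finToFun T) ∎
    where
    open ≤-Reasoning
    degree : Fin 2 → Fin M → ℕ
    degree z x = ∑[ y < M ] 𝟙 (HasColour? z x y)
    degrees : ∀ x → ∑[ z < 2 ] degree z x ≡ M
    degrees x = trans (∑-comm _) (trans (∑-cong λ y → bits-partition (c x y)) (trans (∑-const M 1) (*-identityʳ M)))
    choices : ∀ z x → ∑[ T < M ^ t ] 𝟙 (Chosen? z (finToFun T) x) ≡ degree z x ^ t
    choices z x = trans (∑-cong λ T → 𝟙-all λ i → HasColour? z x (finToFun T i))
      (trans (∑-∏ M t λ i y → 𝟙 (HasColour? z x y)) (∏-const t (degree z x)))

  -- If `S` has fewer than `n` common neighbours, then all `t` entries of a sample for which `S` is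
  -- bad lie among them, which leaves at most `n ^ t` samples.
  ∑-badTuples : ∑[ z < 2 ] ∑[ T < M ^ t ] badTuples z (finToFun T) ≤ 2 * (M ^ Δ * n ^ t)
  ∑-badTuples = begin
    ∑[ z < 2 ] ∑[ T < M ^ t ] badTuples z (finToFun T)
      ≡⟨ ∑-cong (λ z → ∑-comm _) ⟩
    ∑[ z < 2 ] ∑[ S < M ^ Δ ] ∑[ T < M ^ t ] badTuple z (finToFun T) (finToFun S)
      ≤⟨ ∑-mono-≤ (λ z → ∑-mono-≤ λ S → rarelyBad z (finToFun S)) ⟩
    ∑[ z < 2 ] ∑[ S < M ^ Δ ] (n ^ t)
      ≡⟨ trans (∑-const 2 _) (cong (2 *_) (∑-const (M ^ Δ) (n ^ t))) ⟩
    2 * (M ^ Δ * n ^ t) ∎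
    where
    open ≤-Reasoning
    rarelyBad : ∀ z S → ∑[ T < M ^ t ] badTuple z (finToFun T) S ≤ n ^ t
    rarelyBad z S with codegree z S <? n
    ... | no _ = ≤-trans (≤-reflexive (trans (∑-const (M ^ t) 0) (*-zeroʳ (M ^ t)))) z≤n
    ... | yes small = begin
      ∑[ T < M ^ t ] (1 * 𝟙 (Fin.all? λ i → Joined? z S (finToFun T i)))
        ≡⟨ ∑-cong (λ T → trans (*-identityˡ _) (𝟙-all λ i → Joined? z S (finToFun T i))) ⟩
      ∑[ T < M ^ t ] ∏[ i < t ] 𝟙 (Joined? z S (finToFun T i))
        ≡⟨ ∑-∏ M t (λ i y → 𝟙 (Joined? z S y)) ⟩
      ∏[ i < t ] codegree z S
        ≡⟨ ∏-const t _ ⟩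
      codegree z S ^ t
        ≤⟨ ^-monoˡ-≤ t (<⇒≤ small) ⟩
      n ^ t ∎

  -- The factor `M` lets one bad tuple outweigh `chosen`, which is at most `M`. Averaging will
  -- therefore give a sample with no bad tuple at all, and no vertices have to be deleted
  -- afterwards.
  ∑-badTuples<∑-chosen : ∀ a → 2 ^ t * (2 * (M ^ t * a) + M * (2 * (M ^ Δ * n ^ t))) < M ^ t * M →
    ∑[ z < 2 ] ∑[ T < M ^ t ] (a + M * badTuples z (finToFun T)) < ∑[ z < 2 ] ∑[ T < M ^ t ] chosen z (finToFun T)
  ∑-badTuples<∑-chosen a large = *-cancelˡ-< (2 ^ t) _ _ (begin-strict
    2 ^ t * ∑[ z < 2 ] ∑[ T < M ^ t ] (a + M * badTuples z (finToFun T))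
      ≡⟨ cong (2 ^ t *_) expand ⟩
    2 ^ t * (2 * (M ^ t * a) + M * ∑[ z < 2 ] ∑[ T < M ^ t ] badTuples z (finToFun T))
      ≤⟨ *-monoʳ-≤ (2 ^ t) (+-monoʳ-≤ (2 * (M ^ t * a)) (*-monoʳ-≤ M ∑-badTuples)) ⟩
    2 ^ t * (2 * (M ^ t * a) + M * (2 * (M ^ Δ * n ^ t)))
      <⟨ large ⟩
    M ^ t * M
      ≤⟨ ∑-chosen ⟩
    2 ^ t * ∑[ z < 2 ] ∑[ T < M ^ t ] chosen z (finToFun T) ∎)
    where
    open ≤-Reasoning
    expand : ∑[ z < 2 ] ∑[ T < M ^ t ] (a + M * badTuples z (finToFun T)) ≡
             2 * (M ^ t * a) + M * ∑[ z < 2 ] ∑[ T < M ^ t ] badTuples z (finToFun T)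
    expand = trans (∑-cong λ z → trans (∑-distrib-+ _ _) (cong₂ _+_ (∑-const (M ^ t) a) (sym (*-distribˡ-∑ M _))))
      (trans (∑-distrib-+ _ _) (cong₂ _+_ (∑-const 2 (M ^ t * a)) (sym (*-distribˡ-∑ M _))))

  dependentRandomChoice : ∀ a → 2 ^ t * (2 * (M ^ t * a) + M * (2 * (M ^ Δ * n ^ t))) < M ^ t * M →
    ∃ λ z → Σ (Fin a → Fin M) λ e → Injective _≡_ _≡_ e × (∀ (S : Fin Δ → Fin a) → n ≤ codegree z (e ∘ S))
  dependentRandomChoice a large
    with z , lt′ ← ∑-<⇒∃< _ _ (∑-badTuples<∑-chosen a large)
    with T₀ , lt ← ∑-<⇒∃< _ _ lt′
    with T ← finToFun {M} {t} T₀
    -- All `a` indices share one candidate set, the vertices chosen by `T`, which has at least `a`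
    -- elements.
    with e , e-inj , e-chosen ← distinct-representatives {m = a} (λ _ → Chosen? z T)
           (λ _ → ≤-trans (m≤m+n a _) (<⇒≤ lt))
    -- A tuple of small codegree would be bad, and then `chosen z T` would exceed `M`.
    = z , e , e-inj , λ S → ≮⇒≥ λ small → <-irrefl refl (begin-strict
        M                       ≡⟨ *-identityʳ M ⟨
        M * 1                   ≤⟨ *-monoʳ-≤ M (counted (e ∘ S) small λ i j → e-chosen (S j) i) ⟩
        M * badTuples z T       ≤⟨ m≤n+m _ a ⟩
        a + M * badTuples z T   <⟨ lt ⟩
        chosen z T              ≤⟨ chosen≤ z T ⟩
        M                       ∎)
    where
    open ≤-Reasoning
    codegree-≗ : ∀ z {S S′ : Fin Δ → Fin M} → S ≗ S′ → codegree z S ≤ codegree z S′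
    codegree-≗ z {S} {S′} S≗S′ = ∑-mono-≤ λ y → 𝟙-mono (Joined? z S y) (Joined? z S′ y)
      λ joined j → trans (cong (λ x → c x y) (sym (S≗S′ j))) (joined j)
    counted : ∀ {z T} (S : Fin Δ → Fin M) → codegree z S < n → (∀ i → Joined z S (T i)) → 1 ≤ badTuples z T
    counted {z} {T} S small joined = begin
      1
        ≡⟨ cong₂ _*_
             (𝟙-yes (codegree z S′ <? n) (≤-<-trans (codegree-≗ z (finToFun-funToFin S)) small))
             (𝟙-yes (Fin.all? λ i → Joined? z S′ (T i))
               λ i j → trans (cong (λ x → c x (T i)) (finToFun-funToFin S j)) (joined i j)) ⟨
      badTuple z T S′
        ≤⟨ term≤∑ (badTuple z T ∘ finToFun) (funToFin S) ⟩
      badTuples z T ∎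
      where S′ = finToFun (funToFin S)

-- The counting argument

opaque
  hostSize : ℕ → ℕ → ℕ
  hostSize Δ n = 16 * (4 ^ Δ * (n * n))

opaque
  unfolding hostSize

  -- The condition of dependent random choice for samples of size `Δ + Δ`. Relative to the
  -- right-hand side, the first summand is at most 2/16, since `4 ^ Δ * a ≤ W` and `H` is `16 * W`;
  -- the second is at most 8/16, since `4 * (4 * (n * n)) ^ Δ ≤ H ^ Δ`.
  hostSize-large : ∀ Δ n a → 1 ≤ Δ → 1 ≤ n → a ≤ n → let H = hostSize Δ n in
    2 ^ (Δ + Δ) * (2 * (H ^ (Δ + Δ) * a) + H * (2 * (H ^ Δ * n ^ (Δ + Δ)))) < H ^ (Δ + Δ) * H
  hostSize-large Δ n a 1≤Δ 1≤n a≤n = begin-strict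
    2 ^ (Δ + Δ) * (2 * (H ^ (Δ + Δ) * a) + H * (2 * (Q * n ^ (Δ + Δ))))
      ≡⟨ cong₂ (λ p q → p * (2 * (q * a) + H * (2 * (Q * n ^ (Δ + Δ))))) 2^2Δ (^-distribˡ-+-* H Δ Δ) ⟩
    4 ^ Δ * (2 * (Q * Q * a) + H * (2 * (Q * n ^ (Δ + Δ))))
      ≡⟨ regroup (4 ^ Δ) Q a H (n ^ (Δ + Δ)) ⟩
    2 * (Q * Q) * (4 ^ Δ * a) + 2 * H * Q * (4 ^ Δ * n ^ (Δ + Δ))
      ≤⟨ +-mono-≤ (*-monoʳ-≤ (2 * (Q * Q)) (*-monoʳ-≤ (4 ^ Δ) (≤-trans a≤n (m≤n*m n n))))
                  (*-monoʳ-≤ (2 * H * Q) (≤-reflexive 4n²^Δ)) ⟩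
    2 * (Q * Q) * W + 2 * H * Q * Y
      ≡⟨ quarters Q W Y ⟩
    2 * (Q * Q) * W + 8 * (W * Q) * (4 * Y)
      ≤⟨ +-monoʳ-≤ (2 * (Q * Q) * W) (*-monoʳ-≤ (8 * (W * Q)) 4Y≤Q) ⟩
    2 * (Q * Q) * W + 8 * (W * Q) * Q
      ≡⟨ collect Q W ⟩
    10 * (Q * Q * W)
      <⟨ *-monoˡ-< (Q * Q * W) (m≤m+n 11 5) ⟩
    16 * (Q * Q * W)
      ≡⟨ finish Q W ⟩
    Q * Q * H
      ≡⟨ cong (_* H) (^-distribˡ-+-* H Δ Δ) ⟨
    H ^ (Δ + Δ) * H ∎
    where
    open ≤-Reasoning
    H : ℕ
    H = hostSize Δ n
    Q : ℕ
    Q = H ^ Δ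
    W : ℕ
    W = 4 ^ Δ * (n * n)
    Y : ℕ
    Y = (4 * (n * n)) ^ Δ
    instance
      n≢0 : NonZero n
      n≢0 = >-nonZero 1≤n
      n²≢0 : NonZero (n * n)
      n²≢0 = m*n≢0 n n
      4^Δ≢0 : NonZero (4 ^ Δ)
      4^Δ≢0 = m^n≢0 4 Δ
      W≢0 : NonZero W
      W≢0 = m*n≢0 (4 ^ Δ) (n * n)
      H≢0 : NonZero H
      H≢0 = m*n≢0 16 W
      Q≢0 : NonZero Q
      Q≢0 = m^n≢0 H Δ
      Q²≢0 : NonZero (Q * Q)
      Q²≢0 = m*n≢0 Q Q
      Q²W≢0 : NonZero (Q * Q * W)
      Q²W≢0 = m*n≢0 (Q * Q) W
    2^2Δ : 2 ^ (Δ + Δ) ≡ 4 ^ Δ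
    2^2Δ = trans (^-distribˡ-+-* 2 Δ Δ) (sym (^-distribʳ-* Δ 2 2))
    4n²^Δ : 4 ^ Δ * n ^ (Δ + Δ) ≡ Y
    4n²^Δ = trans (cong (4 ^ Δ *_) (trans (^-distribˡ-+-* n Δ Δ) (sym (^-distribʳ-* Δ n n)))) (sym (^-distribʳ-* Δ 4 (n * n)))
    4Y≤Q : 4 * Y ≤ Q
    4Y≤Q = begin
      4 * Y                    ≤⟨ *-monoˡ-≤ Y (^-monoʳ-≤ 4 1≤Δ) ⟩
      4 ^ Δ * Y                ≡⟨ ^-distribʳ-* Δ 4 (4 * (n * n)) ⟨
      (4 * (4 * (n * n))) ^ Δ  ≤⟨ ^-monoˡ-≤ Δ (≤-trans (≤-reflexive (sym (*-assoc 4 4 (n * n)))) (*-monoʳ-≤ 16 (m≤n*m (n * n) (4 ^ Δ)))) ⟩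
      Q                        ∎
    regroup : ∀ p q a M r → p * (2 * (q * q * a) + M * (2 * (q * r))) ≡ 2 * (q * q) * (p * a) + 2 * M * q * (p * r)
    regroup = solve-∀
    quarters : ∀ q w y → 2 * (q * q) * w + 2 * (16 * w) * q * y ≡ 2 * (q * q) * w + 8 * (w * q) * (4 * y)
    quarters = solve-∀
    collect : ∀ q w → 2 * (q * q) * w + 8 * (w * q) * q ≡ 10 * (q * q * w)
    collect = solve-∀
    finish : ∀ q w → 16 * (q * q * w) ≡ q * q * (16 * w)
    finish = solve-∀

does-true⇒ : {P : Set} (P? : Dec P) → does P? ≡ true → P
does-true⇒ (yes p) _ = p

-- Relabelling and isomorphism classes

pullback : Graph n → (Fin m → Fin n) → Graph m
pullback H σ = record
  { adj   = λ u v → adj H (σ u) (σ v)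
  ; sym   = λ u v → Graph.sym H (σ u) (σ v)
  ; irref = λ u → irref H (σ u)
  }

pullback-arrows : (H : Graph n) (σ : Fin m → Fin n) → Injective _≡_ _≡_ σ → Arrows N H → Arrows N (pullback H σ)
pullback-arrows H σ σ-inj arrows χ with b , f , f-inj , mono ← arrows χ =
  b , f ∘ σ , σ-inj ∘ f-inj , λ u v → mono (σ u) (σ v)

Embedding : Graph m → Graph n → (Fin m → Fin n) → Set
Embedding G H σ = Injective _≡_ _≡_ σ × (∀ u v → adj G u v ≡ adj H (σ u) (σ v))

-- Between graphs of equal order this amounts to isomorphism with the inverse left implicit. A bare
-- map can be searched for through its codes and passed to `pullback`.
Embeds : Graph m → Graph n → Set
Embeds G H = ∃ (Embedding G H)

Embeds? : (G : Graph m) (H : Graph n) → Dec (Embeds G H)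
Embeds? G H = ∃-function?
  (λ σ≗τ (inj , pres) → Injective-≗ σ≗τ inj , λ u v → trans (pres u v) (cong₂ (adj H) (σ≗τ u) (σ≗τ v)))
  (λ σ → injective? σ ×-dec Fin.all? λ u → Fin.all? λ v → adj G u v Bool.≟ adj H (σ u) (σ v))

isomorphic⇒embeds : {G H : Graph n} → Isomorphic G H → Embeds G H
isomorphic⇒embeds (σ , pres) = Inverse.to σ , Injection.injective (↔⇒↣ σ) , pres

isomorphic-sym : {G H : Graph n} → Isomorphic G H → Isomorphic H G
isomorphic-sym {H = H} (σ , pres) = ↔-sym σ , λ u v →
  sym (trans (pres _ _) (cong₂ (adj H) (Inverse.strictlyInverseˡ σ u) (Inverse.strictlyInverseˡ σ v)))

-- Greedy, from the last graph to the first: a graph is kept exactly if it embeds in none of those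
-- kept so far.
representatives : (Hs : Fin m → Graph n) → ∃ λ k → Σ (Fin k → Fin m) λ r →
  (∀ i j → i ≢ j → ¬ Isomorphic (Hs (r i)) (Hs (r j))) × (∀ i → ∃ λ j → Embeds (Hs i) (Hs (r j)))
representatives {zero} Hs = 0 , (λ ()) , (λ ()) , λ ()
representatives {suc m} Hs with k , r , distinct , covers ← representatives (Hs ∘ suc)
  with Fin.any? (λ j → Embeds? (Hs zero) (Hs (suc (r j))))
... | yes old = k , suc ∘ r , distinct , λ where
        zero    → old
        (suc i) → covers i
... | no new = suc k , r⁺ , distinct⁺ , covers⁺
  where
  r⁺ : Fin (suc k) → Fin (suc m)
  r⁺ zero    = zero
  r⁺ (suc j) = suc (r j)
  distinct⁺ : ∀ i j → i ≢ j → ¬ Isomorphic (Hs (r⁺ i)) (Hs (r⁺ j))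
  distinct⁺ zero    zero    i≢j = contradiction refl i≢j
  distinct⁺ zero    (suc j) i≢j iso = new (j , isomorphic⇒embeds {G = Hs zero} {Hs (suc (r j))} iso)
  distinct⁺ (suc i) zero    i≢j iso = distinct⁺ zero (suc i) (i≢j ∘ sym) (isomorphic-sym {G = Hs (suc (r i))} {Hs zero} iso)
  distinct⁺ (suc i) (suc j) i≢j = distinct i j (i≢j ∘ cong suc)
  covers⁺ : ∀ i → ∃ λ j → Embeds (Hs i) (Hs (r⁺ j))
  covers⁺ zero    = zero , id , id , λ u v → refl
  covers⁺ (suc i) with j , emb ← covers i = suc j , emb

-- The graphs to be embedded are bipartite, so the complete bipartite graph between two parts of the
-- vertex set is host enough.
crossColours : Colouring (m + n) → Fin m → Fin n → Fin 2
crossColours {m} {n} χ x y = Inverse.from 2↔Bool (col χ (x ↑ˡ n) (m ↑ʳ y))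

n<2^n : ∀ n → n < 2 ^ n
n<2^n zero    = s≤s z≤n
n<2^n (suc n) = +-mono-≤ (m^n>0 2 n) (≤-trans (n<2^n n) (m≤m+n _ 0))

-- Bipartite block graphs and their saturated supergraphs

module BlockGraphs (Δ K B : ℕ) where

  order : ℕ
  order = Δ * K + B

  left : Fin (Δ * K) → Fin order
  left a = a ↑ˡ B

  right : Fin B → Fin order
  right b = (Δ * K) ↑ʳ b

  Choice : Set
  Choice = Fin B → Fin Δ → Fin K

  -- `combine i k` is the `k`-th vertex of block `i`.
  Chooses? : (g : Choice) (a : Fin (Δ * K)) (b : Fin B) → Dec (∃ λ i → a ≡ combine i (g b i))
  Chooses? g a b = Fin.any? λ i → a Fin.≟ combine i (g b i)

  joined : Choice → Fin (Δ * K) ⊎ Fin B → Fin (Δ * K) ⊎ Fin B → Bool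
  joined g (inj₁ a) (inj₂ b) = does (Chooses? g a b)
  joined g (inj₂ b) (inj₁ a) = does (Chooses? g a b)
  joined g (inj₁ _) (inj₁ _) = false
  joined g (inj₂ _) (inj₂ _) = false

  joined-sym : ∀ g p q → joined g p q ≡ joined g q p
  joined-sym g (inj₁ _) (inj₂ _) = refl
  joined-sym g (inj₂ _) (inj₁ _) = refl
  joined-sym g (inj₁ _) (inj₁ _) = refl
  joined-sym g (inj₂ _) (inj₂ _) = refl

  joined-irrefl : ∀ g p → joined g p p ≡ false
  joined-irrefl g (inj₁ _) = refl
  joined-irrefl g (inj₂ _) = refl

  blockGraph : Choice → Graph order
  blockGraph g = record
    { adj   = λ u v → joined g (splitAt (Δ * K) u) (splitAt (Δ * K) v)
    ; sym   = λ u v → joined-sym g (splitAt (Δ * K) u) (splitAt (Δ * K) v)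
    ; irref = λ u → joined-irrefl g (splitAt (Δ * K) u)
    }

  blockGraph-edge : ∀ g b i → adj (blockGraph g) (left (combine i (g b i))) (right b) ≡ true
  blockGraph-edge g b i
    rewrite splitAt-↑ˡ (Δ * K) (combine i (g b i)) B | splitAt-↑ʳ (Δ * K) B b =
    dec-true (Chooses? g (combine i (g b i)) b) (i , refl)

  ramseyBound : ℕ
  ramseyBound = hostSize Δ order + hostSize Δ order

  module _ {M : ℕ} (e : Fin (Δ * K) → Fin M) (e-inj : Injective _≡_ _≡_ e)
           (y : Fin B → Fin M) (y-inj : Injective _≡_ _≡_ y) where

    assemble : Fin order → Fin (M + M)
    assemble = join M M ∘ Sum.map e y ∘ splitAt (Δ * K)

    assemble-injective : Injective _≡_ _≡_ assemble
    assemble-injective {u} {v} eq = begin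
      u                                    ≡⟨ join-splitAt (Δ * K) B u ⟨
      join (Δ * K) B (splitAt (Δ * K) u)   ≡⟨ cong (join (Δ * K) B) (map-injective (splitAt (Δ * K) u) (splitAt (Δ * K) v) (begin
        Sum.map e y (splitAt (Δ * K) u)      ≡⟨ splitAt-join M M _ ⟨
        splitAt M (assemble u)               ≡⟨ cong (splitAt M) eq ⟩
        splitAt M (assemble v)               ≡⟨ splitAt-join M M _ ⟩
        Sum.map e y (splitAt (Δ * K) v)      ∎)) ⟩
      join (Δ * K) B (splitAt (Δ * K) v)   ≡⟨ join-splitAt (Δ * K) B v ⟩
      v                                    ∎
      where
      open ≡-Reasoning
      map-injective : ∀ p q → Sum.map e y p ≡ Sum.map e y q → p ≡ q
      map-injective (inj₁ _) (inj₁ _) eq = cong inj₁ (e-inj (inj₁-injective eq))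
      map-injective (inj₂ _) (inj₂ _) eq = cong inj₂ (y-inj (inj₂-injective eq))

    assemble-mono : ∀ g (χ : Colouring (M + M)) c →
                    (∀ b i → col χ (e (combine i (g b i)) ↑ˡ M) (M ↑ʳ y b) ≡ c) →
                    ∀ u v → adj (blockGraph g) u v ≡ true → col χ (assemble u) (assemble v) ≡ c
    assemble-mono g χ c mono u v = joined-mono (splitAt (Δ * K) u) (splitAt (Δ * K) v)
      where
      joined-mono : ∀ p q → joined g p q ≡ true →
                    col χ (join M M (Sum.map e y p)) (join M M (Sum.map e y q)) ≡ c
      joined-mono (inj₁ a) (inj₂ b) ab with i , refl ← does-true⇒ (Chooses? g a b) ab = mono b i
      joined-mono (inj₂ b) (inj₁ a) ab with i , refl ← does-true⇒ (Chooses? g a b) ab =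
        trans (colSym χ _ _) (mono b i)

  module _ {M : ℕ} (χ : Colouring (M + M)) where

    open BipartiteColouring (crossColours {M} {M} χ)

    -- A right vertex has to go to a common neighbour of the images of its `Δ` selected vertices.
    -- Each right vertex has at least `order`, hence at least `B`, candidates, so distinct ones
    -- exist for all of them.
    blockGraph-copy : ∀ g z (e : Fin (Δ * K) → Fin M) → Injective _≡_ _≡_ e →
                      (∀ (S : Fin Δ → Fin (Δ * K)) → order ≤ codegree z (e ∘ S)) →
                      MonoCopy (blockGraph g) χ
    blockGraph-copy g z e e-inj rich =
      let neighbours : Fin B → Fin Δ → Fin M
          neighbours b i = e (combine i (g b i))
          (y , y-inj , y-joined) = distinct-representatives {P = λ b → Joined z (neighbours b)}
            (λ b → Joined? z (neighbours b))
            (λ b → ≤-trans (m≤n+m B (Δ * K)) (rich λ i → combine i (g b i)))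
      in Inverse.to 2↔Bool z , assemble e e-inj y y-inj , assemble-injective e e-inj y y-inj
       , assemble-mono e e-inj y y-inj g χ _ λ b i → sym (Inverse.inverseˡ 2↔Bool (sym (y-joined b i)))

  blockGraph-arrows : ∀ g → 1 ≤ Δ → 1 ≤ order → Arrows ramseyBound (blockGraph g)
  blockGraph-arrows g 1≤Δ 1≤order χ =
    -- Samples have size `Δ + Δ`, and the chosen vertices receive the `Δ * K` left vertices.
    let (z , e , e-inj , rich) = DependentRandomChoice.dependentRandomChoice (crossColours χ) Δ order (Δ + Δ) (Δ * K)
          (hostSize-large Δ order (Δ * K) 1≤Δ 1≤order (m≤m+n (Δ * K) B))
    in blockGraph-copy χ g z e e-inj rich

  -- Arranged by right vertex and block, to match the factors of the product in
  -- `contained≤2^crossEdges`.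
  crossEdges : Graph order → ℕ
  crossEdges H = ∑[ b < B ] ∑[ i < Δ ] ∑[ k < K ] edge H (left (combine i k)) (right b)

  crossEdges≤edges : ∀ H → crossEdges H ≤ edges id H
  crossEdges≤edges H = begin
    crossEdges H
      ≡⟨ trans (∑-cong λ b → sym (∑-combine Δ K _)) (∑-comm _) ⟩
    ∑[ a < Δ * K ] ∑[ b < B ] edge H (left a) (right b)
      ≡⟨ ∑-cong (λ a → ∑-cong λ b → trans (cong (_* edge H (left a) (right b)) (𝟙-yes (_ Fin.<? _) (left<right a b))) (*-identityˡ _)) ⟨
    ∑[ a < Δ * K ] ∑[ b < B ] ordered (left a) (right b)
      ≤⟨ ∑-mono-≤ (λ a → ≤-trans (m≤n+m _ _) (≤-reflexive (sym (∑-split (Δ * K) B (ordered (left a)))))) ⟩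
    ∑[ a < Δ * K ] ∑[ v < order ] ordered (left a) v
      ≤⟨ ≤-trans (m≤m+n _ _) (≤-reflexive (sym (∑-split (Δ * K) B λ u → ∑ order (ordered u)))) ⟩
    edges id H ∎
    where
    open ≤-Reasoning
    ordered : Fin order → Fin order → ℕ
    ordered u v = 𝟙 (u Fin.<? v) * edge H u v
    left<right : ∀ a b → left a Fin.< right b
    left<right a b = subst₂ _<_ (sym (toℕ-↑ˡ a B)) (sym (toℕ-↑ʳ (Δ * K) b)) (≤-trans (toℕ<n a) (m≤m+n (Δ * K) _))

  -- Decoded in two stages, so that `∑-∏` can separate first the right vertices and then the blocks.
  choice : Fin ((K ^ Δ) ^ B) → Choice
  choice c b = finToFun (finToFun {K ^ Δ} {B} c b)

  contained : Graph order → ℕ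
  contained H = ∑[ c < (K ^ Δ) ^ B ] 𝟙 (blockGraph (choice c) ⊆? H)

  -- For each right vertex and block, a block graph inside `H` uses one of the `d` edges of `H`
  -- between them. Bounding each `d` by `2 ^ d` turns the product of these numbers into a power of 2
  -- whose exponent counts edges.
  contained≤2^crossEdges : ∀ H → contained H ≤ 2 ^ crossEdges H
  contained≤2^crossEdges H = begin
    contained H
      ≤⟨ ∑-mono-≤ present ⟩
    ∑[ c < (K ^ Δ) ^ B ] ∏[ b < B ] ∏[ i < Δ ] edgeAt b i (choice c b i)
      ≡⟨ ∑-∏ (K ^ Δ) B (λ b h → ∏[ i < Δ ] edgeAt b i (finToFun h i)) ⟩
    ∏[ b < B ] ∑[ h < K ^ Δ ] ∏[ i < Δ ] edgeAt b i (finToFun h i)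
      ≡⟨ ∏-cong (λ b → ∑-∏ K Δ (edgeAt b)) ⟩
    ∏[ b < B ] ∏[ i < Δ ] ∑ K (edgeAt b i)
      ≤⟨ ∏-mono-≤ (λ b → ∏-mono-≤ λ i → <⇒≤ (n<2^n (∑ K (edgeAt b i)))) ⟩
    ∏[ b < B ] ∏[ i < Δ ] (2 ^ ∑ K (edgeAt b i))
      ≡⟨ trans (∏-cong λ b → ∏-^-∑ Δ 2 _) (∏-^-∑ B 2 _) ⟩
    2 ^ crossEdges H ∎
    where
    open ≤-Reasoning
    edgeAt : Fin B → Fin Δ → Fin K → ℕ
    edgeAt b i k = edge H (left (combine i k)) (right b)
    present : ∀ c → 𝟙 (blockGraph (choice c) ⊆? H) ≤ ∏[ b < B ] ∏[ i < Δ ] edgeAt b i (choice c b i)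
    present c with blockGraph (choice c) ⊆? H
    ... | no _    = z≤n
    ... | yes G⊆H = ≤-reflexive (sym (∏-ones λ b → ∏-ones λ i →
      𝟙-yes (adj H (left (combine i (choice c b i))) (right b) Bool.≟ true) (G⊆H _ _ (blockGraph-edge (choice c) b i))))

  arrows⇒contained≤ : ∀ H → Arrows N H → contained H ≤ 2 * N ^ order
  arrows⇒contained≤ H arrows = ≤-trans (contained≤2^crossEdges H)
    (≤-trans (^-monoʳ-≤ 2 (crossEdges≤edges H)) (arrows⇒few-edges H arrows))

  module _ {N : ℕ} (closure : Fin ((K ^ Δ) ^ B) → Graph order)
           (⊆closure : ∀ c → blockGraph (choice c) ⊆ closure c) (arrows : ∀ c → Arrows N (closure c)) where

    -- Every block graph lies in `pullback (closure (r j)) σ` for some `j` and some injective `σ`.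
    -- There are at most `k * order ^ order` such pullbacks, and each still satisfies `Arrows N`, so
    -- it contains few block graphs.
    covering-bound : ∀ k (r : Fin k → Fin ((K ^ Δ) ^ B)) → (∀ c → ∃ λ j → Embeds (closure c) (closure (r j))) →
            (K ^ Δ) ^ B ≤ k * (order ^ order * (2 * N ^ order))
    covering-bound k r covers = begin
      (K ^ Δ) ^ B
        ≡⟨ trans (∑-const ((K ^ Δ) ^ B) 1) (*-identityʳ _) ⟨
      ∑[ c < (K ^ Δ) ^ B ] 1
        ≤⟨ ∑-mono-≤ covered ⟩
      ∑[ c < (K ^ Δ) ^ B ] ∑[ j < k ] ∑[ σ < order ^ order ] copies c j (finToFun σ)
        ≡⟨ trans (∑-comm _) (∑-cong λ j → ∑-comm λ c σ → copies c j (finToFun σ)) ⟩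
      ∑[ j < k ] ∑[ σ < order ^ order ] ∑[ c < (K ^ Δ) ^ B ] copies c j (finToFun σ)
        ≤⟨ ∑-mono-≤ (λ j → ∑-mono-≤ λ σ → fewCopies j (finToFun σ)) ⟩
      ∑[ j < k ] ∑[ σ < order ^ order ] (2 * N ^ order)
        ≡⟨ trans (∑-const k _) (cong (k *_) (∑-const (order ^ order) _)) ⟩
      k * (order ^ order * (2 * N ^ order)) ∎
      where
      open ≤-Reasoning
      copies : Fin ((K ^ Δ) ^ B) → Fin k → (Fin order → Fin order) → ℕ
      copies c j σ = 𝟙 (injective? σ) * 𝟙 (blockGraph (choice c) ⊆? pullback (closure (r j)) σ)
      covered : ∀ c → 1 ≤ ∑[ j < k ] ∑[ σ < order ^ order ] copies c j (finToFun σ)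
      covered c with j , σ , σ-inj , pres ← covers c = begin
        1
          ≡⟨ cong₂ _*_ (𝟙-yes (injective? σ′) (Injective-≗ (sym ∘ finToFun-funToFin σ) σ-inj))
               (𝟙-yes (blockGraph (choice c) ⊆? pullback (closure (r j)) σ′) λ u v uv →
                 trans (cong₂ (adj (closure (r j))) (finToFun-funToFin σ u) (finToFun-funToFin σ v))
                   (trans (sym (pres u v)) (⊆closure c u v uv))) ⟨
        copies c j σ′
          ≤⟨ term≤∑ (λ τ → copies c j (finToFun τ)) (funToFin σ) ⟩
        ∑[ τ < order ^ order ] copies c j (finToFun τ)
          ≤⟨ term≤∑ (λ j → ∑[ τ < order ^ order ] copies c j (finToFun τ)) j ⟩
        ∑[ j < k ] ∑[ τ < order ^ order ] copies c j (finToFun τ) ∎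
        where σ′ = finToFun (funToFin σ)
      fewCopies : ∀ j σ → ∑[ c < (K ^ Δ) ^ B ] copies c j σ ≤ 2 * N ^ order
      fewCopies j σ with injective? σ
      ... | no _ = ≤-trans (≤-reflexive (trans (∑-const ((K ^ Δ) ^ B) 0) (*-zeroʳ ((K ^ Δ) ^ B)))) z≤n
      ... | yes σ-inj = ≤-trans (≤-reflexive (∑-cong λ c → *-identityˡ _))
        (arrows⇒contained≤ (pullback (closure (r j)) σ)
          (pullback-arrows (closure (r j)) σ σ-inj (arrows (r j))))

  module _ (1≤Δ : 1 ≤ Δ) (1≤order : 1 ≤ order) where

    saturation : ∀ c → Σ (Graph order) λ H → blockGraph (choice c) ⊆ H × Arrows ramseyBound H × RamseySaturated H
    saturation c = saturate (blockGraph (choice c)) (blockGraph-arrows (choice c) 1≤Δ 1≤order)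

    many-saturated : ∃ λ k → Σ (Fin k → Graph order) λ Gs →
      (K ^ Δ) ^ B ≤ k * (order ^ order * (2 * ramseyBound ^ order)) ×
      (∀ i → RamseySaturated (Gs i)) × (∀ i j → i ≢ j → ¬ Isomorphic (Gs i) (Gs j))
    many-saturated =
      let (k , r , distinct , covers) = representatives (proj₁ ∘ saturation)
      in k , proj₁ ∘ saturation ∘ r
       , covering-bound (proj₁ ∘ saturation) (proj₁ ∘ proj₂ ∘ saturation) (proj₁ ∘ proj₂ ∘ proj₂ ∘ saturation) k r covers
       , proj₂ ∘ proj₂ ∘ proj₂ ∘ saturation ∘ r , distinct

-- Numerical estimates

opaque
  unfolding hostSize

  -- With `P` for `2 ^ Δ`, the factors are `32 ≤ P`, which is `5 ≤ Δ`, then `4 ^ Δ`, which is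
  -- `P * P`, and `n * n ≤ P * P`.
  hostSize-small : ∀ Δ n → 5 ≤ Δ → n ≤ 2 ^ Δ → hostSize Δ n + hostSize Δ n ≤ (2 ^ Δ) ^ 5
  hostSize-small Δ n 5≤Δ n≤P = begin
    16 * (4 ^ Δ * (n * n)) + 16 * (4 ^ Δ * (n * n))  ≡⟨ double (4 ^ Δ * (n * n)) ⟩
    32 * (4 ^ Δ * (n * n))                           ≤⟨ *-mono-≤ (^-monoʳ-≤ 2 5≤Δ) (*-mono-≤ (≤-reflexive (^-distribʳ-* Δ 2 2)) (*-mono-≤ n≤P n≤P)) ⟩
    2 ^ Δ * (2 ^ Δ * 2 ^ Δ * (2 ^ Δ * 2 ^ Δ))        ≡⟨ fifth (2 ^ Δ) ⟩
    (2 ^ Δ) ^ 5 ∎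
    where
    open ≤-Reasoning
    double : ∀ a → 16 * a + 16 * a ≡ 32 * a
    double = solve-∀
    fifth : ∀ p → p * (p * p * (p * p)) ≡ p * (p * (p * (p * (p * 1))))
    fifth = solve-∀

opaque
  -- The exponent 16 is twice 8: as `n ≤ 2 * B`, there are at least `(2 ^ (Δ * n)) ^ 8` choices,
  -- against a seventh power in the cofactor of `k`.
  blockSize : ℕ
  blockSize = 2 ^ 16

  blockSize≡2^16 : blockSize ≡ 2 ^ 16
  blockSize≡2^16 = refl

instance
  2*blockSize≢0 : NonZero (2 * blockSize)
  2*blockSize≢0 = subst (λ K → NonZero (2 * K)) (sym blockSize≡2^16) _

-- Everything is measured in `X`, which is `2 ^ (Δ * n)`. The cofactor of `k` is at most `X ^ 7`:
-- one factor for `n ^ n`, one for 2 and five for the host. The left-hand side is at least `X ^ 8`,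
-- so `X ≤ k`, and `n ≤ D * Δ` finishes.
count⇒2^n² : ∀ k Δ B n D → n ≤ 2 * B → 5 ≤ Δ → 1 ≤ n → n ≤ 2 ^ Δ → n ≤ D * Δ →
             (blockSize ^ Δ) ^ B ≤ k * (n ^ n * (2 * (hostSize Δ n + hostSize Δ n) ^ n)) →
             2 ^ (n * n) ≤ k ^ D
count⇒2^n² k Δ B n D n≤2B 5≤Δ 1≤n n≤P n≤DΔ count = begin
  2 ^ (n * n)          ≤⟨ ^-monoʳ-≤ 2 (≤-trans (*-monoˡ-≤ n n≤DΔ) (≤-reflexive (rotate D Δ n))) ⟩
  2 ^ (Δ * n * D)      ≡⟨ ^-*-assoc 2 (Δ * n) D ⟨
  (2 ^ (Δ * n)) ^ D    ≡⟨ cong (_^ D) (^-*-assoc 2 Δ n) ⟨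
  X ^ D                ≤⟨ ^-monoˡ-≤ D X≤k ⟩
  k ^ D                ∎
  where
  open ≤-Reasoning
  P = 2 ^ Δ
  X = P ^ n
  rotate : ∀ d δ n → d * δ * n ≡ δ * n * d
  rotate = solve-∀
  instance
    P≢0 : NonZero P
    P≢0 = m^n≢0 2 Δ
    X^7≢0 : NonZero (X ^ 7)
    X^7≢0 = m^n≢0 X 7 {{m^n≢0 P n}}
  2≤X : 2 ≤ X
  2≤X = begin
    2 ^ 1  ≤⟨ ^-monoʳ-≤ 2 (≤-trans (s≤s z≤n) 5≤Δ) ⟩
    P      ≡⟨ ^-identityʳ P ⟨
    P ^ 1  ≤⟨ ^-monoʳ-≤ P 1≤n ⟩
    X      ∎
  hosts≤X^5 : (hostSize Δ n + hostSize Δ n) ^ n ≤ X ^ 5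
  hosts≤X^5 = begin
    (hostSize Δ n + hostSize Δ n) ^ n  ≤⟨ ^-monoˡ-≤ n (hostSize-small Δ n 5≤Δ n≤P) ⟩
    (P ^ 5) ^ n                        ≡⟨ ^-*-assoc P 5 n ⟩
    P ^ (5 * n)                        ≡⟨ cong (P ^_) (*-comm 5 n) ⟩
    P ^ (n * 5)                        ≡⟨ ^-*-assoc P n 5 ⟨
    X ^ 5                              ∎
  X^8≤ : X ^ 8 ≤ (blockSize ^ Δ) ^ B
  X^8≤ = begin
    X ^ 8                    ≡⟨ cong (_^ 8) (^-*-assoc 2 Δ n) ⟩
    (2 ^ (Δ * n)) ^ 8        ≡⟨ ^-*-assoc 2 (Δ * n) 8 ⟩
    2 ^ (Δ * n * 8)          ≤⟨ ^-monoʳ-≤ 2 (≤-trans (*-monoˡ-≤ 8 (*-monoʳ-≤ Δ n≤2B)) (≤-reflexive (exponents Δ B))) ⟩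
    2 ^ (16 * Δ * B)         ≡⟨ ^-*-assoc 2 (16 * Δ) B ⟨
    (2 ^ (16 * Δ)) ^ B       ≡⟨ cong (_^ B) (^-*-assoc 2 16 Δ) ⟨
    ((2 ^ 16) ^ Δ) ^ B       ≡⟨ cong (λ K → (K ^ Δ) ^ B) blockSize≡2^16 ⟨
    (blockSize ^ Δ) ^ B      ∎
    where
    exponents : ∀ δ b → δ * (2 * b) * 8 ≡ 16 * δ * b
    exponents = solve-∀
  X≤k : X ≤ k
  X≤k = *-cancelʳ-≤ X k (X ^ 7) (begin
    X ^ 8                    ≤⟨ X^8≤ ⟩
    (blockSize ^ Δ) ^ B      ≤⟨ count ⟩
    k * (n ^ n * (2 * (hostSize Δ n + hostSize Δ n) ^ n))
      ≤⟨ *-monoʳ-≤ k (*-mono-≤ (^-monoˡ-≤ n n≤P) (*-mono-≤ 2≤X hosts≤X^5)) ⟩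
    k * X ^ 7 ∎)

-- The factor `2 ^ 17` is `2 * blockSize`. Cancelling it for `Δ` equal to `18 + y` leaves
-- `19 + y ≤ 2 ^ suc y`; the route through `2 * suc y` needs `17 ≤ y`, whence 35.
linear≤2^ : ∀ Δ → 35 ≤ Δ → 2 ^ 17 * suc Δ ≤ 2 ^ Δ
linear≤2^ Δ 35≤Δ = begin
  2 ^ 17 * suc Δ                ≡⟨ cong (λ d → 2 ^ 17 * suc d) Δ≡ ⟨
  2 ^ 17 * suc (18 + y)         ≤⟨ *-monoʳ-≤ (2 ^ 17) (linear y 17≤y) ⟩
  2 ^ 17 * 2 ^ suc y            ≡⟨ ^-distribˡ-+-* 2 17 (suc y) ⟨
  2 ^ (17 + suc y)              ≡⟨ cong (2 ^_) Δ≡ ⟩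
  2 ^ Δ                         ∎
  where
  open ≤-Reasoning
  y = Δ ∸ 18
  Δ≡ : 18 + y ≡ Δ
  Δ≡ = m+[n∸m]≡n (≤-trans (m≤m+n 18 17) 35≤Δ)
  17≤y : 17 ≤ y
  17≤y = ∸-monoˡ-≤ 18 35≤Δ
  linear : ∀ y → 17 ≤ y → suc (18 + y) ≤ 2 ^ suc y
  linear y 17≤y = begin
    19 + y               ≤⟨ +-monoˡ-≤ y (s≤s (s≤s 17≤y)) ⟩
    suc (suc y) + y      ≡⟨ twice y ⟩
    2 * suc y            ≤⟨ *-monoʳ-≤ 2 (n<2^n y) ⟩
    2 ^ suc y            ∎
    where
    twice : ∀ y → suc (suc y) + y ≡ 2 * suc y
    twice = solve-∀

-- Choice of the parameters

m<n*[1+m/n] : ∀ m n .{{_ : NonZero n}} → m < n * suc (m / n)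
m<n*[1+m/n] m n = begin-strict
  m                    ≡⟨ m≡m%n+[m/n]*n m n ⟩
  m % n + m / n * n    <⟨ +-monoˡ-< (m / n * n) (m%n<n m n) ⟩
  n + m / n * n        ≡⟨ *-comm (suc (m / n)) n ⟩
  n * suc (m / n)      ∎
  where open ≤-Reasoning

theorem3p1 : Σ ℕ λ d → Σ ℕ λ N₀ → ∀ n → N₀ ≤ n →
    Σ ℕ λ k → Σ (Fin k → Graph n) λ Gs →
    (2 ^ (n * n) ≤ k ^ suc d)
    × (∀ i → RamseySaturated (Gs i))
    × (∀ i j → i ≢ j → ¬ Isomorphic (Gs i) (Gs j))
-- The constant is `c = 1 / (4 * blockSize + 1)`. Each block graph has `n / Q` blocks, all other
-- vertices go to the right side, and `N₀ = Q * 35` ensures at least 35 blocks.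
theorem3p1 = 4 * blockSize , Q * 35 , λ n N₀≤n → fromBlocks n (n / Q) (n ∸ n / Q * blockSize)
  (m+[n∸m]≡n (≤-trans (*-monoʳ-≤ (n / Q) (m≤m+n blockSize _)) (m/n*n≤m n Q)))
  (35≤n/Q n N₀≤n) (m/n*n≤m n Q) (m<n*[1+m/n] n Q)
  where
  Q = 2 * blockSize

  35≤n/Q : ∀ n → Q * 35 ≤ n → 35 ≤ n / Q
  35≤n/Q n N₀≤n = ≤-trans (≤-reflexive (sym (trans (cong (_/ Q) (*-comm Q 35)) (m*n/n≡m 35 Q)))) (/-monoˡ-≤ Q N₀≤n)

  -- An arbitrary `n` is tied to the blocks by an equation, whose elimination turns it into the
  -- order of the block graphs.
  fromBlocks : ∀ n Δ B → Δ * blockSize + B ≡ n → 35 ≤ Δ → Δ * Q ≤ n → n < Q * suc Δ →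
    Σ ℕ λ k → Σ (Fin k → Graph n) λ Gs →
    (2 ^ (n * n) ≤ k ^ suc (4 * blockSize))
    × (∀ i → RamseySaturated (Gs i))
    × (∀ i j → i ≢ j → ¬ Isomorphic (Gs i) (Gs j))
  fromBlocks n Δ B refl 35≤Δ ΔQ≤n n<QsΔ =
    let (k , Gs , count , saturated , distinct) = BlockGraphs.many-saturated Δ blockSize B 1≤Δ 1≤n
    in k , Gs , count⇒2^n² k Δ B n (suc (4 * blockSize)) n≤2B (≤-trans (m≤m+n 5 30) 35≤Δ) 1≤n n≤2^Δ n≤DΔ count , saturated , distinct
    where
    open ≤-Reasoning
    1≤Δ : 1 ≤ Δ
    1≤Δ = ≤-trans (s≤s z≤n) 35≤Δ
    1≤n : 1 ≤ n
    1≤n = begin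
      1      ≤⟨ *-mono-≤ 1≤Δ (>-nonZero⁻¹ Q) ⟩
      Δ * Q  ≤⟨ ΔQ≤n ⟩
      n      ∎
    n≤2B : n ≤ 2 * B
    -- Since `Q` is twice `blockSize`, the blocks take up at most half of the vertices. Adding `n`
    -- to both sides avoids halving.
    n≤2B = +-cancelˡ-≤ n _ _ (begin
      n + n                             ≡⟨ split (Δ * blockSize) B ⟩
      2 * (Δ * blockSize) + 2 * B       ≡⟨ cong (_+ 2 * B) (shift Δ blockSize) ⟩
      Δ * Q + 2 * B                     ≤⟨ +-monoˡ-≤ (2 * B) ΔQ≤n ⟩
      n + 2 * B                         ∎)
      where
      split : ∀ a b → (a + b) + (a + b) ≡ 2 * a + 2 * b
      split = solve-∀
      shift : ∀ δ k → 2 * (δ * k) ≡ δ * (2 * k)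
      shift = solve-∀
    n≤2^Δ : n ≤ 2 ^ Δ
    n≤2^Δ = begin
      n                  ≤⟨ <⇒≤ n<QsΔ ⟩
      Q * suc Δ          ≡⟨ cong (λ K → 2 * K * suc Δ) blockSize≡2^16 ⟩
      2 ^ 17 * suc Δ     ≤⟨ linear≤2^ Δ 35≤Δ ⟩
      2 ^ Δ              ∎
    n≤DΔ : n ≤ suc (4 * blockSize) * Δ
    n≤DΔ = begin
      n                        ≤⟨ <⇒≤ n<QsΔ ⟩
      -- The rounding in `n / Q` is absorbed by a factor 2, which accounts for `4 * blockSize` in
      -- place of `Q`.
      Q * suc Δ                ≤⟨ *-monoʳ-≤ Q (+-monoˡ-≤ Δ 1≤Δ) ⟩
      Q * (Δ + Δ)              ≡⟨ fourfold blockSize Δ ⟩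
      4 * blockSize * Δ        ≤⟨ m≤n+m _ Δ ⟩
      suc (4 * blockSize) * Δ  ∎
      where
      fourfold : ∀ k δ → 2 * k * (δ + δ) ≡ 4 * k * δ
      fourfold = solve-∀
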